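{- Assume the setting described in the context, and assume moreover that cotupling $[-,-]$ in $\mathcal{K}l(T)$ is monotonic in both arguments and that each zero morphism $0_{X,Y}:X\multimap Y$ is the least element of the poset $Hom_{\mathcal{K}l(T)}(X,Y)$. Then for every $\alpha:X\multimap\overline{F_\tau}X$, every bisimulation on the $TF_\tau$-coalgebra $\alpha^{\bigstar}:X\to TF_\tau X$ is a bisimulation on the $TF^*$-coalgebra $\underline{\alpha}^{\divideontimes}:X\to TF^*X$.
   Context: Let $\mathsf{C}$ be a category with binary coproducts and $(T,\mu,\eta)$ a monad on $\mathsf{C}$. In the Kleisli category $\mathcal{K}l(T)$ (objects of $\mathsf{C}$; morphisms $X\multimap Y$ are $\mathsf{C}$-morphisms $X\to TY$; composition $g\cdot f=\mu_Z\circ Tg\circ f$; identity $1_X=\eta_X$) write $f^\sharp=\eta_Y\circ f$ for $f:X\to Y$ in $\mathsf{C}$; coproducts of $\mathcal{K}l(T)$ are those of $\mathsf{C}$, with coprojections $\iota^1,\iota^2$ and cotupling $[-,-]$. $\mathcal{K}l(T)$ is order-enriched (hom-sets are posets, composition monotone) and $T$ is an order saturation monad: for every $\alpha:X\multimap X$ there is $\alpha^{*}:X\multimap X$ with (a) $1\le\alpha^*$, (b) $\alpha\le\alpha^*$, (c) $\alpha^*\cdot\alpha^*\le\alpha^*$, (d) if $\beta:X\multimap X$ satisfies $1\le\beta$, $\alpha\le\beta$, $\beta\cdot\beta\le\beta$ then $\alpha^*\le\beta$, (e) for all $f:X\to Y$ in $\mathsf{C}$, $\beta:Y\multimap Y$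 and $\Box\in\{\le,\ge\}$: $f^\sharp\cdot\alpha\mathrel{\Box}\beta\cdot f^\sharp$ implies $f^\sharp\cdot\alpha^*\mathrel{\Box}\beta^*\cdot f^\sharp$. A functor $S$ on $\mathsf{C}$ lifts to $\overline{S}$ on $\mathcal{K}l(T)$ if $\overline{S}X=SX$ and $\overline{S}(f^\sharp)=(Sf)^\sharp$; if $(\overline{S},m,e)$ is a monad on $\mathcal{K}l(T)$ then $TS$ is a monad on $\mathsf{C}$ whose Kleisli category is $\mathcal{K}l(\overline{S})$, with hom-sets $Hom_{\mathcal{K}l(T)}(X,\overline{S}Y)$ ordered as in $\mathcal{K}l(T)$. Standing assumptions: $\mathcal{K}l(T)$ has zero morphisms $0_{X,Y}$ (with $f\cdot 0=0=0\cdot g$). $F:\mathsf{C}\to\mathsf{C}$ lifts to $\overline{F}$, so $F_\tau=F+\mathcal{I}d$ lifts to $\overline{F_\tau}=\overline{F}+\mathcal{I}d$, which is a monad $(\overline{F_\tau},m',e')$ on $\mathcal{K}l(T)$ with $e'_X=\iota^2:X\multimap\overline{F}X+X$ and $m'_X=[\iota^1,id]\cdot(\overline{F}([0,id])+id):\overline{F}(\overline{F}X+X)+(\overline{F}X+X)\multimap\overline{F}X+X$. $F$ admits all free $F$-algebras, giving the free monad $F^*$ on $\mathsf{C}$; it lifts to $\overline{F}^*$ on $\mathcal{K}l(T)$ and $(\overline{F}^*,m,e)$ is the free monad over $\overline{F}$ in $\mathcal{K}l(T)$ with universal natural transformation $\nu:\overline{F}\Rightarrow\overline{F}^*$. For both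 $(\overline{S},m,e)=(\overline{F_\tau},m',e')$ and $(\overline{S},m,e)=(\overline{F}^*,m,e)$, $\overline{S}$ is locally monotonic and $m_X\cdot\overline{S}[(m_X\cdot\overline{S}\alpha)^*\cdot e_X]=(m_X\cdot\overline{S}\alpha)^*$ for all $\alpha:X\multimap\overline{S}X$. For $\alpha:X\multimap\overline{F_\tau}X$ put $\alpha^{\bigstar}=(m'_X\cdot\overline{F_\tau}\alpha)^*\cdot e'_X$, and for $\beta:Y\multimap\overline{F}^*Y$ put $\beta^{\divideontimes}=(m_Y\cdot\overline{F}^*\beta)^*\cdot e_Y$ (these are saturation operators making $TF_\tau$ and $TF^*$ order saturation monads). For $\alpha:X\multimap\overline{F_\tau}X$ let $\underline{\alpha}=[\nu_X,e_X]\cdot\alpha:X\multimap\overline{F}^*X$. Bisimulation (kernel bisimulation): for an endofunctor $G$ on $\mathsf{C}$ and $G$-coalgebras $\alpha:X\to GX$, $\beta:Y\to GY$, a jointly monic span $X\xleftarrow{\pi_1}R\xrightarrow{\pi_2}Y$ is a bisimulation if there exist a $G$-coalgebra $\gamma:Z\to GZ$ and coalgebra homomorphisms $f$ from $\alpha$ to $\gamma$ and $g$ from $\beta$ to $\gamma$ (i.e. $Gf\circ\alpha=\gamma\circ f$, $Gg\circ\beta=\gamma\circ g$) such that $(R,\pi_1,\pi_2)$ is the pullback of $X\xrightarrow{f}Z\xleftarrow{g}Y$. A bisimulation on a coalgebra is a bisimulation between it and itself. -}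

module Defs where

open import Level using (Level; _⊔_) renaming (suc to lsuc)
open import Relation.Binary.PropositionalEquality using (_≡_)
open import Relation.Binary.Structures using (IsPartialOrder)
open import Data.Product using (Σ; _×_; _,_)

-- raw category data (used for the Kleisli category, whose laws are
-- consequences of the monad laws and need not be re-assumed)
record RawCat (o h : Level) : Set (lsuc (o ⊔ h)) where
  infixr 9 _∘_
  field
    Obj : Set o
    Hom : Obj → Obj → Set h
    id  : ∀ {X} → Hom X X
    _∘_ : ∀ {X Y Z} → Hom Y Z → Hom X Y → Hom X Z

record Category (o h : Level) : Set (lsuc (o ⊔ h)) where
  field
    raw : RawCat o h
  open RawCat raw public
  field
    idˡ   : ∀ {X Y} (f : Hom X Y) → id ∘ f ≡ f
    idʳ   : ∀ {X Y} (f : Hom X Y) → f ∘ id ≡ f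
    assoc : ∀ {W X Y Z} (h : Hom Y Z) (g : Hom X Y) (f : Hom W X) →
            (h ∘ g) ∘ f ≡ h ∘ (g ∘ f)

module _ {o h : Level} (C : RawCat o h) where
  open RawCat C

  record IsEndofunctor (S₀ : Obj → Obj)
                       (S₁ : ∀ {X Y} → Hom X Y → Hom (S₀ X) (S₀ Y)) : Set (o ⊔ h) where
    field
      S-id : ∀ {X} → S₁ (id {X}) ≡ id
      S-∘  : ∀ {X Y Z} (g : Hom Y Z) (f : Hom X Y) → S₁ (g ∘ f) ≡ S₁ g ∘ S₁ f

  IsNatural : (S₀ : Obj → Obj) (S₁ : ∀ {X Y} → Hom X Y → Hom (S₀ X) (S₀ Y))
              (S₀' : Obj → Obj) (S₁' : ∀ {X Y} → Hom X Y → Hom (S₀' X) (S₀' Y))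
              (σ : ∀ X → Hom (S₀ X) (S₀' X)) → Set (o ⊔ h)
  IsNatural S₀ S₁ S₀' S₁' σ = ∀ {X Y} (f : Hom X Y) → σ Y ∘ S₁ f ≡ S₁' f ∘ σ X

  record IsMonad (S₀ : Obj → Obj)
                 (S₁ : ∀ {X Y} → Hom X Y → Hom (S₀ X) (S₀ Y))
                 (e : ∀ X → Hom X (S₀ X))
                 (m : ∀ X → Hom (S₀ (S₀ X)) (S₀ X)) : Set (o ⊔ h) where
    field
      isFunctor : IsEndofunctor S₀ S₁
      e-natural : ∀ {X Y} (f : Hom X Y) → e Y ∘ f ≡ S₁ f ∘ e X
      m-natural : ∀ {X Y} (f : Hom X Y) → m Y ∘ S₁ (S₁ f) ≡ S₁ f ∘ m X
      m-e       : ∀ X → m X ∘ e (S₀ X) ≡ id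
      m-Se      : ∀ X → m X ∘ S₁ (e X) ≡ id
      m-assoc   : ∀ X → m X ∘ S₁ (m X) ≡ m X ∘ m (S₀ X)

  record MonadOn : Set (o ⊔ h) where
    field
      S₀ : Obj → Obj
      S₁ : ∀ {X Y} → Hom X Y → Hom (S₀ X) (S₀ Y)
      e  : ∀ X → Hom X (S₀ X)
      m  : ∀ X → Hom (S₀ (S₀ X)) (S₀ X)
      isMonad : IsMonad S₀ S₁ e m

  record IsMonadMorphism
           (S₀ : Obj → Obj) (S₁ : ∀ {X Y} → Hom X Y → Hom (S₀ X) (S₀ Y))
           (e : ∀ X → Hom X (S₀ X)) (m : ∀ X → Hom (S₀ (S₀ X)) (S₀ X))
           (S₀' : Obj → Obj) (S₁' : ∀ {X Y} → Hom X Y → Hom (S₀' X) (S₀' Y))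
           (e' : ∀ X → Hom X (S₀' X)) (m' : ∀ X → Hom (S₀' (S₀' X)) (S₀' X))
           (σ : ∀ X → Hom (S₀ X) (S₀' X)) : Set (o ⊔ h) where
    field
      natural : IsNatural S₀ S₁ S₀' S₁' σ
      pres-e  : ∀ X → σ X ∘ e X ≡ e' X
      pres-m  : ∀ X → σ X ∘ m X ≡ m' X ∘ (S₁' (σ X) ∘ σ (S₀ X))

module _ {o h : Level} (C : Category o h) where
  open Category C

  record Endofunctor : Set (o ⊔ h) where
    field
      F₀ : Obj → Obj
      F₁ : ∀ {X Y} → Hom X Y → Hom (F₀ X) (F₀ Y)
      isFunctor : IsEndofunctor raw F₀ F₁

  record Monad : Set (o ⊔ h) where
    field
      T₀ : Obj → Obj
      T₁ : ∀ {X Y} → Hom X Y → Hom (T₀ X) (T₀ Y)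
      η  : ∀ X → Hom X (T₀ X)
      μ  : ∀ X → Hom (T₀ (T₀ X)) (T₀ X)
      isMonad : IsMonad raw T₀ T₁ η μ

  record BinCoproducts : Set (o ⊔ h) where
    infixr 6 _+_
    field
      _+_   : Obj → Obj → Obj
      ι₁    : ∀ {X Y} → Hom X (X + Y)
      ι₂    : ∀ {X Y} → Hom Y (X + Y)
      [_,_] : ∀ {X Y Z} → Hom X Z → Hom Y Z → Hom (X + Y) Z
      β₁    : ∀ {X Y Z} (f : Hom X Z) (g : Hom Y Z) → [ f , g ] ∘ ι₁ ≡ f
      β₂    : ∀ {X Y Z} (f : Hom X Z) (g : Hom Y Z) → [ f , g ] ∘ ι₂ ≡ g
      [,]-unique : ∀ {X Y Z} (f : Hom X Z) (g : Hom Y Z) (k : Hom (X + Y) Z) →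
                   k ∘ ι₁ ≡ f → k ∘ ι₂ ≡ g → k ≡ [ f , g ]

  record FreeAlgebras (F : Endofunctor) : Set (o ⊔ h) where
    open Endofunctor F
    field
      F*₀  : Obj → Obj
      φ    : ∀ X → Hom (F₀ (F*₀ X)) (F*₀ X)
      η*   : ∀ X → Hom X (F*₀ X)
      fold : ∀ {X A} → Hom (F₀ A) A → Hom X A → Hom (F*₀ X) A
      fold-φ : ∀ {X A} (a : Hom (F₀ A) A) (f : Hom X A) →
               fold a f ∘ φ X ≡ a ∘ F₁ (fold a f)
      fold-η : ∀ {X A} (a : Hom (F₀ A) A) (f : Hom X A) → fold a f ∘ η* X ≡ f
      fold-unique : ∀ {X A} (a : Hom (F₀ A) A) (f : Hom X A) (k : Hom (F*₀ X) A) →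
                    k ∘ φ X ≡ a ∘ F₁ k → k ∘ η* X ≡ f → k ≡ fold a f
    F*₁ : ∀ {X Y} → Hom X Y → Hom (F*₀ X) (F*₀ Y)
    F*₁ {Y = Y} f = fold (φ Y) (η* Y ∘ f)

  record IsPullback {X Y Z R : Obj} (f : Hom X Z) (g : Hom Y Z)
                    (π₁ : Hom R X) (π₂ : Hom R Y) : Set (o ⊔ h) where
    field
      commutes  : f ∘ π₁ ≡ g ∘ π₂
      universal : ∀ {W} (p : Hom W X) (q : Hom W Y) → f ∘ p ≡ g ∘ q →
                  Σ (Hom W R) λ u → (π₁ ∘ u ≡ p) × (π₂ ∘ u ≡ q)
      unique    : ∀ {W} (u u' : Hom W R) → π₁ ∘ u ≡ π₁ ∘ u' → π₂ ∘ u ≡ π₂ ∘ u' → u ≡ u'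

  record IsBisimulation (G₀ : Obj → Obj)
                        (G₁ : ∀ {X Y} → Hom X Y → Hom (G₀ X) (G₀ Y))
                        {X Y : Obj} (α : Hom X (G₀ X)) (β : Hom Y (G₀ Y))
                        {R : Obj} (π₁ : Hom R X) (π₂ : Hom R Y) : Set (o ⊔ h) where
    field
      jointlyMonic : ∀ {W} (u v : Hom W R) → π₁ ∘ u ≡ π₁ ∘ v → π₂ ∘ u ≡ π₂ ∘ v → u ≡ v
      Z    : Obj
      γ    : Hom Z (G₀ Z)
      f    : Hom X Z
      g    : Hom Y Z
      f-hom : G₁ f ∘ α ≡ γ ∘ f
      g-hom : G₁ g ∘ β ≡ γ ∘ g
      pullback : IsPullback f g π₁ π₂

module Kleisli {o h : Level} (C : Category o h) (cp : BinCoproducts C) (M : Monad C) where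
  open Category C
  open BinCoproducts cp
  open Monad M

  infixr 0 _⊸_
  _⊸_ : Obj → Obj → Set h
  X ⊸ Y = Hom X (T₀ Y)

  infixr 9 _·_
  _·_ : ∀ {X Y Z} → Y ⊸ Z → X ⊸ Y → X ⊸ Z
  _·_ {Z = Z} g f = μ Z ∘ (T₁ g ∘ f)

  1K : ∀ X → X ⊸ X
  1K X = η X

  _♯ : ∀ {X Y} → Hom X Y → X ⊸ Y
  _♯ {Y = Y} f = η Y ∘ f

  Kl : RawCat o h
  Kl = record { Obj = Obj ; Hom = _⊸_ ; id = λ {X} → 1K X ; _∘_ = _·_ }

  ι¹ : ∀ {X Y} → X ⊸ X + Y
  ι¹ = ι₁ ♯
  ι² : ∀ {X Y} → Y ⊸ X + Y
  ι² = ι₂ ♯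

  [_,_]K : ∀ {X Y Z} → X ⊸ Z → Y ⊸ Z → X + Y ⊸ Z
  [ f , g ]K = [ f , g ]

  _+K_ : ∀ {X X' Y Y'} → X ⊸ X' → Y ⊸ Y' → X + Y ⊸ X' + Y'
  f +K g = [ ι¹ · f , ι² · g ]K

  record OrderSaturation : Set (lsuc (o ⊔ h)) where
    infix 4 _≤_
    field
      _≤_   : ∀ {X Y} → X ⊸ Y → X ⊸ Y → Set h
      isPartialOrder : ∀ {X Y} → IsPartialOrder (_≡_ {A = X ⊸ Y}) _≤_
      ·-mono : ∀ {X Y Z} {f f' : X ⊸ Y} {g g' : Y ⊸ Z} →
               f ≤ f' → g ≤ g' → g · f ≤ g' · f'
      _*    : ∀ {X} → X ⊸ X → X ⊸ X
      sat-a : ∀ {X} (α : X ⊸ X) → 1K X ≤ α *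
      sat-b : ∀ {X} (α : X ⊸ X) → α ≤ α *
      sat-c : ∀ {X} (α : X ⊸ X) → α * · α * ≤ α *
      sat-d : ∀ {X} (α β : X ⊸ X) → 1K X ≤ β → α ≤ β → β · β ≤ β → α * ≤ β
      sat-e-≤ : ∀ {X Y} (f : Hom X Y) (α : X ⊸ X) (β : Y ⊸ Y) →
                (f ♯) · α ≤ β · (f ♯) → (f ♯) · (α *) ≤ (β *) · (f ♯)
      sat-e-≥ : ∀ {X Y} (f : Hom X Y) (α : X ⊸ X) (β : Y ⊸ Y) →
                β · (f ♯) ≤ (f ♯) · α → (β *) · (f ♯) ≤ (f ♯) · (α *)

  record ZeroMorphisms : Set (o ⊔ h) where
    field
      0K : ∀ X Y → X ⊸ Y
      0-left  : ∀ {X Y Z : Obj} (f : Y ⊸ Z) → f · 0K X Y ≡ 0K X Z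
      0-right : ∀ {W X Y : Obj} (g : W ⊸ X) → 0K X Y · g ≡ 0K W Y

  record Lifting (S₀ : Obj → Obj) (S₁ : ∀ {X Y} → Hom X Y → Hom (S₀ X) (S₀ Y)) : Set (o ⊔ h) where
    field
      lift₁ : ∀ {X Y} → X ⊸ Y → S₀ X ⊸ S₀ Y
      isFunctor : IsEndofunctor Kl S₀ lift₁
      lifts : ∀ {X Y} (f : Hom X Y) → lift₁ (f ♯) ≡ (S₁ f) ♯

  module _ (O : OrderSaturation) where
    open OrderSaturation O
    SatCompatible : (S₀ : Obj → Obj) (S₁ : ∀ {X Y} → X ⊸ Y → S₀ X ⊸ S₀ Y)
                    (e : ∀ X → X ⊸ S₀ X) (m : ∀ X → S₀ (S₀ X) ⊸ S₀ X) → Set (o ⊔ h)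
    SatCompatible S₀ S₁ e m =
      (∀ {X Y} {f g : X ⊸ Y} → f ≤ g → S₁ f ≤ S₁ g) ×
      (∀ X (α : X ⊸ S₀ X) → m X · S₁ (((m X · S₁ α) *) · e X) ≡ (m X · S₁ α) *)

    CotupleMonotone : Set (o ⊔ h)
    CotupleMonotone = ∀ {X Y Z} {f f' : X ⊸ Z} {g g' : Y ⊸ Z} →
                      f ≤ f' → g ≤ g' → [ f , g ]K ≤ [ f' , g' ]K

    ZeroLeast : ZeroMorphisms → Set (o ⊔ h)
    ZeroLeast Z = ∀ {X Y} (f : X ⊸ Y) → ZeroMorphisms.0K Z X Y ≤ f

module Tau {o h : Level} (C : Category o h) (cp : BinCoproducts C) (M : Monad C)
           (Z : Kleisli.ZeroMorphisms C cp M) (F : Endofunctor C)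
           (Fl : Kleisli.Lifting C cp M (Endofunctor.F₀ F) (Endofunctor.F₁ F)) where
  open Category C
  open BinCoproducts cp
  open Kleisli C cp M
  open ZeroMorphisms Z
  open Endofunctor F
  open Lifting Fl

  Fτ₀ : Obj → Obj
  Fτ₀ X = F₀ X + X
  Fτ₁ : ∀ {X Y} → Hom X Y → Hom (Fτ₀ X) (Fτ₀ Y)
  Fτ₁ f = [ ι₁ ∘ F₁ f , ι₂ ∘ f ]

  F̄τ₁ : ∀ {X Y} → X ⊸ Y → Fτ₀ X ⊸ Fτ₀ Y
  F̄τ₁ f = lift₁ f +K f

  e' : ∀ X → X ⊸ Fτ₀ X
  e' X = ι²

  m' : ∀ X → Fτ₀ (Fτ₀ X) ⊸ Fτ₀ X
  m' X = [ ι¹ , 1K (Fτ₀ X) ]K · (lift₁ [ 0K (F₀ X) X , 1K X ]K +K 1K (Fτ₀ X))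

record Setting (o h : Level) : Set (lsuc (o ⊔ h)) where
  field
    C  : Category o h
    cp : BinCoproducts C
    M  : Monad C
  open Category C
  open BinCoproducts cp
  open Monad M
  open Kleisli C cp M
  field
    ord  : OrderSaturation
    zero : ZeroMorphisms
    F    : Endofunctor C
  open OrderSaturation ord
  open Endofunctor F
  field
    F-lift : Lifting F₀ F₁
  open Lifting F-lift renaming (lift₁ to F̄₁)
  open Tau C cp M zero F F-lift
  field
    τ-isMonad : IsMonad Kl Fτ₀ F̄τ₁ e' m'
    free : FreeAlgebras C F
  open FreeAlgebras free
  field
    F̄*₁ : ∀ {X Y} → X ⊸ Y → F*₀ X ⊸ F*₀ Y
    F̄*-lifts : ∀ {X Y} (f : Hom X Y) → F̄*₁ (f ♯) ≡ (F*₁ f) ♯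
    m : ∀ X → F*₀ (F*₀ X) ⊸ F*₀ X
    e : ∀ X → X ⊸ F*₀ X
    *-isMonad : IsMonad Kl F*₀ F̄*₁ e m
    ν : ∀ X → F₀ X ⊸ F*₀ X
    ν-natural : IsNatural Kl F₀ F̄₁ F*₀ F̄*₁ ν
    ν-universal :
      (S : MonadOn Kl) (σ : ∀ X → F₀ X ⊸ MonadOn.S₀ S X) →
      IsNatural Kl F₀ F̄₁ (MonadOn.S₀ S) (MonadOn.S₁ S) σ →
      Σ (∀ X → F*₀ X ⊸ MonadOn.S₀ S X) λ σ̂ →
        IsMonadMorphism Kl F*₀ F̄*₁ e m
          (MonadOn.S₀ S) (MonadOn.S₁ S) (MonadOn.e S) (MonadOn.m S) σ̂ ×
        (∀ X → σ̂ X · ν X ≡ σ X) ×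
        (∀ (σ' : ∀ X → F*₀ X ⊸ MonadOn.S₀ S X) →
           IsMonadMorphism Kl F*₀ F̄*₁ e m
             (MonadOn.S₀ S) (MonadOn.S₁ S) (MonadOn.e S) (MonadOn.m S) σ' →
           (∀ X → σ' X · ν X ≡ σ X) → ∀ X → σ' X ≡ σ̂ X)
    τ-sat : SatCompatible ord Fτ₀ F̄τ₁ e' m'
    *-sat : SatCompatible ord F*₀ F̄*₁ e m

  TFτ₀ : Obj → Obj
  TFτ₀ X = T₀ (Fτ₀ X)
  TFτ₁ : ∀ {X Y} → Hom X Y → Hom (TFτ₀ X) (TFτ₀ Y)
  TFτ₁ f = T₁ (Fτ₁ f)

  TF*₀ : Obj → Obj
  TF*₀ X = T₀ (F*₀ X)
  TF*₁ : ∀ {X Y} → Hom X Y → Hom (TF*₀ X) (TF*₀ Y)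
  TF*₁ f = T₁ (F*₁ f)

  _★ : ∀ {X} → X ⊸ Fτ₀ X → X ⊸ Fτ₀ X
  _★ {X} α = ((m' X · F̄τ₁ α) *) · e' X

  _⊛ : ∀ {Y} → Y ⊸ F*₀ Y → Y ⊸ F*₀ Y
  _⊛ {Y} β = ((m Y · F̄*₁ β) *) · e Y

  under : ∀ {X} → X ⊸ Fτ₀ X → X ⊸ F*₀ X
  under {X} α = [ ν X , e X ]K · α

  CotupleMono : Set (o ⊔ h)
  CotupleMono = CotupleMonotone ord

  ZeroIsLeast : Set (o ⊔ h)
  ZeroIsLeast = ZeroLeast ord zero

{-# OPTIONS --safe #-}

-- Put h = [ν, e] : F̄τ ⇒ F̄*.  Since zero is least, h is a lax monad morphism, so h·A ≤ B·h for
-- A = m'·F̄τ α and B = m·F̄* (under α).  Axiom (e) of saturation would turn this into h·A* ≤ B*·h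
-- if h were of the form k♯.  This holds up to an isomorphism: the free algebras of C are also free
-- F̄-algebras in the Kleisli category, so they yield a free monad over F̄ whose unit and universal
-- transformation are of the form k♯, and it is isomorphic to F̄* because both are free.  Hence
-- under (α ★) ≤ (under α) ⊛, so (under α) ⊛ = (under (α ★)) ⊛, and a homomorphism from α ★ to γ is
-- one from (under (α ★)) ⊛ to (under γ) ⊛.
module Submission where

open import Defs
open import Data.Product using (proj₁; proj₂)
open import Relation.Binary.Bundles using (Poset)
open import Relation.Binary.PropositionalEquality
  using (_≡_; refl; sym; trans; cong; cong₂; module ≡-Reasoning)
open import Relation.Binary.Structures using (IsPartialOrder)
import Relation.Binary.Reasoning.PartialOrder as PosetReasoning

-- Associativity calculus and monad morphisms in a category.

module CategoryLemmas {o h} (K : Category o h) where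
  open Category K
  open ≡-Reasoning

  pullˡ : ∀ {W X Y Z} {a : Hom Y Z} {b : Hom X Y} {c : Hom X Z} {f : Hom W X} →
          a ∘ b ≡ c → a ∘ (b ∘ f) ≡ c ∘ f
  pullˡ {a = a} {b} {f = f} p = trans (sym (assoc a b f)) (cong (_∘ f) p)

  pullʳ : ∀ {W X Y Z} {a : Hom Y Z} {b : Hom X Y} {f : Hom W X} {c : Hom W Y} →
          b ∘ f ≡ c → (a ∘ b) ∘ f ≡ a ∘ c
  pullʳ {a = a} {b} {f} p = trans (assoc a b f) (cong (a ∘_) p)

  extendˡ : ∀ {V W X Y Z} {a : Hom Y Z} {b : Hom X Y} {c : Hom W Z} {d : Hom X W} {f : Hom V X} →
            a ∘ b ≡ c ∘ d → a ∘ (b ∘ f) ≡ c ∘ (d ∘ f)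
  extendˡ {c = c} {d} {f} p = trans (pullˡ p) (assoc c d f)

  cancelˡ : ∀ {W X Y} {a : Hom Y X} {b : Hom X Y} {f : Hom W X} → a ∘ b ≡ id → a ∘ (b ∘ f) ≡ f
  cancelˡ {f = f} p = trans (pullˡ p) (idˡ f)

  -- Together with composition below, this supplies the monad morphisms that `extend-restrict`
  -- compares by universality of `ν`.
  idMonadMorphism : ∀ {S₀} {S₁ : ∀ {X Y} → Hom X Y → Hom (S₀ X) (S₀ Y)} {e m} →
                    IsEndofunctor raw S₀ S₁ →
                    IsMonadMorphism raw S₀ S₁ e m S₀ S₁ e m (λ _ → id)
  idMonadMorphism {S₁ = S₁} {e} {m} S = record
    { natural = λ f → trans (idˡ _) (sym (idʳ _))
    ; pres-e  = λ X → idˡ (e X)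
    ; pres-m  = λ X → begin
        id ∘ m X               ≡⟨ idˡ _ ⟩
        m X                    ≡⟨ idʳ _ ⟨
        m X ∘ id               ≡⟨ cong (m X ∘_) (trans (idʳ _) (IsEndofunctor.S-id S)) ⟨
        m X ∘ (S₁ id ∘ id)     ∎
    }

  composeMonadMorphism :
    ∀ {P₀} {P₁ : ∀ {X Y} → Hom X Y → Hom (P₀ X) (P₀ Y)} {eP mP}
      {Q₀} {Q₁ : ∀ {X Y} → Hom X Y → Hom (Q₀ X) (Q₀ Y)} {eQ mQ}
      {S₀} {S₁ : ∀ {X Y} → Hom X Y → Hom (S₀ X) (S₀ Y)} {eS mS} {τ σ} →
    IsEndofunctor raw S₀ S₁ →
    IsMonadMorphism raw Q₀ Q₁ eQ mQ S₀ S₁ eS mS τ →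
    IsMonadMorphism raw P₀ P₁ eP mP Q₀ Q₁ eQ mQ σ →
    IsMonadMorphism raw P₀ P₁ eP mP S₀ S₁ eS mS (λ X → τ X ∘ σ X)
  composeMonadMorphism {P₀} {P₁} {eP} {mP} {Q₀} {Q₁} {eQ} {mQ} {S₀} {S₁} {eS} {mS} {τ} {σ} S Τ Σ′ =
    record
    { natural = λ {X} {Y} f → begin
        (τ Y ∘ σ Y) ∘ P₁ f   ≡⟨ pullʳ (Σ′.natural f) ⟩
        τ Y ∘ (Q₁ f ∘ σ X)   ≡⟨ extendˡ (Τ.natural f) ⟩
        S₁ f ∘ (τ X ∘ σ X)   ∎
    ; pres-e = λ X → trans (pullʳ (Σ′.pres-e X)) (Τ.pres-e X)
    ; pres-m = λ X → begin
        (τ X ∘ σ X) ∘ mP X                                       ≡⟨ pullʳ (Σ′.pres-m X) ⟩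
        τ X ∘ (mQ X ∘ (Q₁ (σ X) ∘ σ (P₀ X)))                     ≡⟨ pullˡ (Τ.pres-m X) ⟩
        (mS X ∘ (S₁ (τ X) ∘ τ (Q₀ X))) ∘ (Q₁ (σ X) ∘ σ (P₀ X))   ≡⟨ pullʳ (assoc _ _ _) ⟩
        mS X ∘ (S₁ (τ X) ∘ (τ (Q₀ X) ∘ (Q₁ (σ X) ∘ σ (P₀ X))))
          ≡⟨ cong (λ k → mS X ∘ (S₁ (τ X) ∘ k)) (extendˡ (Τ.natural (σ X))) ⟩
        mS X ∘ (S₁ (τ X) ∘ (S₁ (σ X) ∘ (τ (P₀ X) ∘ σ (P₀ X))))
          ≡⟨ cong (mS X ∘_) (pullˡ (sym (IsEndofunctor.S-∘ S _ _))) ⟩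
        mS X ∘ (S₁ (τ X ∘ σ X) ∘ (τ (P₀ X) ∘ σ (P₀ X)))          ∎
    }
    where
    module Τ = IsMonadMorphism Τ
    module Σ′ = IsMonadMorphism Σ′

-- Coproduct calculus.

module CoproductLemmas {o h} (K : Category o h) (cp : BinCoproducts K) where
  open Category K
  open BinCoproducts cp
  open CategoryLemmas K

  ∘-[,] : ∀ {X Y Z W} (k : Hom Z W) (f : Hom X Z) (g : Hom Y Z) →
          k ∘ [ f , g ] ≡ [ k ∘ f , k ∘ g ]
  ∘-[,] k f g = [,]-unique _ _ _ (pullʳ (β₁ f g)) (pullʳ (β₂ f g))

  [,]-∘-+ : ∀ {X X′ Y Y′ Z} (f : Hom X′ Z) (g : Hom Y′ Z) (u : Hom X X′) (v : Hom Y Y′) →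
            [ f , g ] ∘ [ ι₁ ∘ u , ι₂ ∘ v ] ≡ [ f ∘ u , g ∘ v ]
  [,]-∘-+ f g u v = trans (∘-[,] _ _ _) (cong₂ [_,_] (pullˡ (β₁ f g)) (pullˡ (β₂ f g)))

-- The free monad obtained from free algebras, and its extension property.

module FreeMonad {o h} (K : Category o h) (F : Endofunctor K) (free : FreeAlgebras K F) where
  open Category K
  open Endofunctor F
  open IsEndofunctor isFunctor renaming (S-id to F-id; S-∘ to F-∘)
  open FreeAlgebras free
  open CategoryLemmas K
  open ≡-Reasoning

  -- An algebra morphism after a fold satisfies the recursion equations of the target fold. Most
  -- monad laws below compare two folds in this way.
  fold-fusion : ∀ {X A B} {a : Hom (F₀ A) A} {b : Hom (F₀ B) B} {f : Hom X A} {k : Hom A B} →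
                k ∘ a ≡ b ∘ F₁ k → k ∘ fold a f ≡ fold b (k ∘ f)
  fold-fusion {X} {a = a} {b} {f} {k} p = fold-unique b (k ∘ f) (k ∘ fold a f)
    (begin
      (k ∘ fold a f) ∘ φ X        ≡⟨ pullʳ (fold-φ a f) ⟩
      k ∘ (a ∘ F₁ (fold a f))     ≡⟨ extendˡ p ⟩
      b ∘ (F₁ k ∘ F₁ (fold a f))  ≡⟨ cong (b ∘_) (F-∘ _ _) ⟨
      b ∘ F₁ (k ∘ fold a f)       ∎)
    (pullʳ (fold-η a f))

  fold-id : ∀ {X} → fold (φ X) (η* X) ≡ id
  fold-id {X} = sym (fold-unique _ _ id
    (trans (idˡ _) (sym (trans (cong (φ X ∘_) F-id) (idʳ _)))) (idˡ _))

  fold-map : ∀ {X Y A} {a : Hom (F₀ A) A} {g : Hom Y A} {f : Hom X Y} →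
             fold a g ∘ F*₁ f ≡ fold a (g ∘ f)
  fold-map {a = a} {g} {f} = trans (fold-fusion (fold-φ a g)) (cong (fold a) (pullˡ (fold-η a g)))

  join : ∀ X → Hom (F*₀ (F*₀ X)) (F*₀ X)
  join X = fold (φ X) id

  F*-functor : IsEndofunctor raw F*₀ F*₁
  F*-functor = record
    { S-id = trans (cong (fold _) (idʳ _)) fold-id
    ; S-∘  = λ g f → sym (trans fold-map (cong (fold _) (assoc _ _ _)))
    }

  freeMonad : MonadOn raw
  freeMonad = record
    { S₀ = F*₀ ; S₁ = F*₁ ; e = η* ; m = join
    ; isMonad = record
      { isFunctor = F*-functor
      ; e-natural = λ f → sym (fold-η _ _)
      ; m-natural = λ f → trans fold-map (trans (cong (fold _) (trans (idˡ _) (sym (idʳ _))))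
                                                (sym (fold-fusion (fold-φ _ _))))
      ; m-e       = λ X → fold-η _ _
      ; m-Se      = λ X → trans fold-map (trans (cong (fold _) (idˡ _)) fold-id)
      ; m-assoc   = λ X → trans fold-map (trans (cong (fold _) (trans (idˡ _) (sym (idʳ _))))
                                                (sym (fold-fusion (fold-φ _ _))))
      }
    }

  unit : ∀ X → Hom (F₀ X) (F*₀ X)
  unit X = φ X ∘ F₁ (η* X)

  unit-natural : IsNatural raw F₀ F₁ F*₀ F*₁ unit
  unit-natural {X} {Y} f = begin
    (φ Y ∘ F₁ (η* Y)) ∘ F₁ f         ≡⟨ pullʳ (sym (F-∘ _ _)) ⟩
    φ Y ∘ F₁ (η* Y ∘ f)              ≡⟨ cong (λ k → φ Y ∘ F₁ k) (fold-η _ _) ⟨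
    φ Y ∘ F₁ (F*₁ f ∘ η* X)          ≡⟨ cong (φ Y ∘_) (F-∘ _ _) ⟩
    φ Y ∘ (F₁ (F*₁ f) ∘ F₁ (η* X))   ≡⟨ extendˡ (fold-φ _ _) ⟨
    F*₁ f ∘ (φ X ∘ F₁ (η* X))        ∎

  -- The free algebra structure is recovered from the multiplication and the universal
  -- transformation; `restrict-alg` relies on this.
  join-unit : ∀ X → join X ∘ unit (F*₀ X) ≡ φ X
  join-unit X = begin
    join X ∘ (φ _ ∘ F₁ (η* _))          ≡⟨ extendˡ (fold-φ _ _) ⟩
    φ X ∘ (F₁ (join X) ∘ F₁ (η* _))     ≡⟨ cong (φ X ∘_) (F-∘ _ _) ⟨
    φ X ∘ F₁ (join X ∘ η* _)            ≡⟨ cong (λ k → φ X ∘ F₁ k) (fold-η _ _) ⟩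
    φ X ∘ F₁ id                         ≡⟨ trans (cong (φ X ∘_) F-id) (idʳ _) ⟩
    φ X                                 ∎

  module Extension {N₀ : Obj → Obj} {N₁ : ∀ {X Y} → Hom X Y → Hom (N₀ X) (N₀ Y)}
                   {e : ∀ X → Hom X (N₀ X)} {m : ∀ X → Hom (N₀ (N₀ X)) (N₀ X)}
                   (N : IsMonad raw N₀ N₁ e m)
                   {ν : ∀ X → Hom (F₀ X) (N₀ X)} (ν-natural : IsNatural raw F₀ F₁ N₀ N₁ ν) where
    open IsMonad N hiding (isFunctor)

    -- A transformation from `F` into a monad makes each `N₀ X` an `F`-algebra, so a monad morphism
    -- out of the free monad can be defined by folding.
    alg : ∀ X → Hom (F₀ (N₀ X)) (N₀ X)
    alg X = m X ∘ ν (N₀ X)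

    extend : ∀ X → Hom (F*₀ X) (N₀ X)
    extend X = fold (alg X) (e X)

    alg-natural : ∀ {X Y} (f : Hom X Y) → N₁ f ∘ alg X ≡ alg Y ∘ F₁ (N₁ f)
    alg-natural {X} {Y} f = begin
      N₁ f ∘ (m X ∘ ν (N₀ X))         ≡⟨ extendˡ (sym (m-natural f)) ⟩
      m Y ∘ (N₁ (N₁ f) ∘ ν (N₀ X))    ≡⟨ cong (m Y ∘_) (ν-natural (N₁ f)) ⟨
      m Y ∘ (ν (N₀ Y) ∘ F₁ (N₁ f))    ≡⟨ assoc _ _ _ ⟨
      alg Y ∘ F₁ (N₁ f)               ∎

    m-alg : ∀ X → m X ∘ alg (N₀ X) ≡ alg X ∘ F₁ (m X)
    m-alg X = begin
      m X ∘ (m (N₀ X) ∘ ν (N₀ (N₀ X)))    ≡⟨ extendˡ (sym (m-assoc X)) ⟩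
      m X ∘ (N₁ (m X) ∘ ν (N₀ (N₀ X)))    ≡⟨ cong (m X ∘_) (ν-natural (m X)) ⟨
      m X ∘ (ν (N₀ X) ∘ F₁ (m X))         ≡⟨ assoc _ _ _ ⟨
      alg X ∘ F₁ (m X)                    ∎

    alg-e : ∀ X → alg X ∘ F₁ (e X) ≡ ν X
    alg-e X = begin
      alg X ∘ F₁ (e X)              ≡⟨ pullʳ (ν-natural (e X)) ⟩
      m X ∘ (N₁ (e X) ∘ ν X)        ≡⟨ cancelˡ (m-Se X) ⟩
      ν X                           ∎

    extend-unit : ∀ X → extend X ∘ unit X ≡ ν X
    extend-unit X = begin
      extend X ∘ (φ X ∘ F₁ (η* X))            ≡⟨ extendˡ (fold-φ _ _) ⟩
      alg X ∘ (F₁ (extend X) ∘ F₁ (η* X))     ≡⟨ cong (alg X ∘_) (F-∘ _ _) ⟨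
      alg X ∘ F₁ (extend X ∘ η* X)            ≡⟨ cong (λ k → alg X ∘ F₁ k) (fold-η _ _) ⟩
      alg X ∘ F₁ (e X)                        ≡⟨ alg-e X ⟩
      ν X                                     ∎

    -- Each law reduces to fusion, because `N₁ f` and `m X` are algebra morphisms for `alg`. In
    -- `pres-m` both sides become the fold into `alg X` that is `extend X` on generators.
    extend-morphism : IsMonadMorphism raw F*₀ F*₁ η* join N₀ N₁ e m extend
    extend-morphism = record
      { natural = λ f → trans fold-map (trans (cong (fold _) (e-natural f))
                                              (sym (fold-fusion (alg-natural f))))
      ; pres-e  = λ X → fold-η _ _
      ; pres-m  = λ X → begin
          extend X ∘ join X                                 ≡⟨ fold-fusion (fold-φ _ _) ⟩
          fold (alg X) (extend X ∘ id)                      ≡⟨ cong (fold _) (idʳ _) ⟩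
          fold (alg X) (extend X)                           ≡⟨ cong (fold _) (cancelˡ (m-e X)) ⟨
          fold (alg X) (m X ∘ (e (N₀ X) ∘ extend X))        ≡⟨ fold-fusion (m-alg X) ⟨
          m X ∘ fold (alg (N₀ X)) (e (N₀ X) ∘ extend X)
            ≡⟨ cong (λ k → m X ∘ fold (alg (N₀ X)) k) (e-natural (extend X)) ⟩
          m X ∘ fold (alg (N₀ X)) (N₁ (extend X) ∘ e (F*₀ X))
            ≡⟨ cong (m X ∘_) (fold-fusion (alg-natural (extend X))) ⟨
          m X ∘ (N₁ (extend X) ∘ extend (F*₀ X))            ∎
      }

-- The Kleisli category, its coproducts and its free algebras.

module KleisliLemmas {o h} (C : Category o h) (cp : BinCoproducts C) (M : Monad C) where
  open Category C
  open BinCoproducts cp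
  open Monad M
  open Kleisli C cp M
  open IsMonad isMonad
  open IsEndofunctor isFunctor using () renaming (S-∘ to T-∘)
  open CategoryLemmas C
  open ≡-Reasoning

  ·-♯ : ∀ {X Y Z} (g : Y ⊸ Z) (f : Hom X Y) → g · f ♯ ≡ g ∘ f
  ·-♯ {Z = Z} g f = begin
    μ Z ∘ (T₁ g ∘ (η _ ∘ f))    ≡⟨ cong (μ Z ∘_) (extendˡ (sym (e-natural g))) ⟩
    μ Z ∘ (η _ ∘ (g ∘ f))       ≡⟨ cancelˡ (m-e Z) ⟩
    g ∘ f                       ∎

  ♯-· : ∀ {X Y Z} (g : Hom Y Z) (f : X ⊸ Y) → g ♯ · f ≡ T₁ g ∘ f
  ♯-· {Z = Z} g f = begin
    μ Z ∘ (T₁ (η Z ∘ g) ∘ f)         ≡⟨ cong (λ k → μ Z ∘ (k ∘ f)) (T-∘ _ _) ⟩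
    μ Z ∘ ((T₁ (η Z) ∘ T₁ g) ∘ f)    ≡⟨ cong (μ Z ∘_) (assoc _ _ _) ⟩
    μ Z ∘ (T₁ (η Z) ∘ (T₁ g ∘ f))    ≡⟨ cancelˡ (m-Se Z) ⟩
    T₁ g ∘ f                         ∎

  ♯-∘ : ∀ {X Y Z} (g : Hom Y Z) (f : Hom X Y) → (g ∘ f) ♯ ≡ g ♯ · f ♯
  ♯-∘ g f = sym (trans (·-♯ _ _) (assoc _ _ _))

  ·-assoc : ∀ {W X Y Z} (k : Y ⊸ Z) (g : X ⊸ Y) (f : W ⊸ X) → (k · g) · f ≡ k · (g · f)
  ·-assoc {Y = Y} {Z} k g f = begin
    μ Z ∘ (T₁ (μ Z ∘ (T₁ k ∘ g)) ∘ f)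
      ≡⟨ cong (λ u → μ Z ∘ (u ∘ f)) (trans (T-∘ _ _) (cong (T₁ (μ Z) ∘_) (T-∘ _ _))) ⟩
    μ Z ∘ ((T₁ (μ Z) ∘ (T₁ (T₁ k) ∘ T₁ g)) ∘ f)    ≡⟨ cong (μ Z ∘_) (pullʳ (assoc _ _ _)) ⟩
    μ Z ∘ (T₁ (μ Z) ∘ (T₁ (T₁ k) ∘ (T₁ g ∘ f)))    ≡⟨ extendˡ (m-assoc Z) ⟩
    μ Z ∘ (μ (T₀ Z) ∘ (T₁ (T₁ k) ∘ (T₁ g ∘ f)))    ≡⟨ cong (μ Z ∘_) (extendˡ (m-natural k)) ⟩
    μ Z ∘ (T₁ k ∘ (μ Y ∘ (T₁ g ∘ f)))              ∎

  K : Category o h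
  K = record
    { raw   = Kl
    ; idˡ   = λ {X} {Y} f → cancelˡ (m-Se Y)
    ; idʳ   = λ f → trans (cong (f ·_) (sym (idʳ _))) (trans (·-♯ f id) (idʳ f))
    ; assoc = ·-assoc
    }

  cpK : BinCoproducts K
  cpK = record
    { _+_ = _+_ ; ι₁ = ι¹ ; ι₂ = ι² ; [_,_] = [_,_]K
    ; β₁ = λ f g → trans (·-♯ _ _) (β₁ f g)
    ; β₂ = λ f g → trans (·-♯ _ _) (β₂ f g)
    ; [,]-unique = λ f g k p q → [,]-unique f g k (trans (sym (·-♯ _ _)) p) (trans (sym (·-♯ _ _)) q)
    }

  module LiftedFreeAlgebras (F : Endofunctor C)
                            (L : Lifting (Endofunctor.F₀ F) (Endofunctor.F₁ F))
                            (free : FreeAlgebras C F) where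
    open Endofunctor F hiding (isFunctor)
    open Lifting L renaming (lift₁ to F̄₁; isFunctor to F̄-functor)
    open FreeAlgebras free

    F̄ : Endofunctor K
    F̄ = record { F₀ = F₀ ; F₁ = F̄₁ ; isFunctor = F̄-functor }

    -- The identity of T A, read as a Kleisli morphism T A ⊸ A, is the counit of the Kleisli
    -- adjunction, so this turns an F̄-algebra on A into an F-algebra on T A.
    transpose : ∀ {A} → F₀ A ⊸ A → Hom (F₀ (T₀ A)) (T₀ A)
    transpose {A} a = a · F̄₁ {T₀ A} {A} id

    -- This turns the recursion equation of a fold into `transpose a` in `C` into the equation for
    -- the `F̄`-algebra `a` in the Kleisli category.
    transpose-∘ : ∀ {A B} (a : F₀ A ⊸ A) (k : B ⊸ A) → transpose a ∘ F₁ k ≡ a · F̄₁ k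
    transpose-∘ {A} a k = begin
      (a · F̄₁ id) ∘ F₁ k           ≡⟨ ·-♯ _ _ ⟨
      (a · F̄₁ id) · (F₁ k) ♯       ≡⟨ ·-assoc _ _ _ ⟩
      a · (F̄₁ id · (F₁ k) ♯)       ≡⟨ cong (λ u → a · (F̄₁ id · u)) (lifts k) ⟨
      a · (F̄₁ id · F̄₁ (k ♯))       ≡⟨ cong (a ·_) (IsEndofunctor.S-∘ F̄-functor _ _) ⟨
      a · F̄₁ (id · k ♯)            ≡⟨ cong (λ u → a · F̄₁ u) (trans (·-♯ _ _) (idˡ k)) ⟩
      a · F̄₁ k                     ∎

    -- A Kleisli morphism out of `F*₀ X` is a `C`-morphism into some `T₀ A`, so the universal
    -- property in `C` applies after transposing the algebra. Its structure maps have the form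
    -- `k ♯`, as axiom (e) demands.
    freeK : FreeAlgebras K F̄
    freeK = record
      { F*₀    = F*₀
      ; φ      = λ X → φ X ♯
      ; η*     = λ X → η* X ♯
      ; fold   = λ a f → fold (transpose a) f
      ; fold-φ = λ a f → trans (·-♯ _ _) (trans (fold-φ _ _) (transpose-∘ a _))
      ; fold-η = λ a f → trans (·-♯ _ _) (fold-η _ _)
      ; fold-unique = λ a f k p q → fold-unique _ _ k
          (trans (sym (·-♯ _ _)) (trans p (sym (transpose-∘ a k)))) (trans (sym (·-♯ _ _)) q)
      }

-- Saturation: transfer along Kleisli isomorphisms, and lifted monads.

module SaturationLemmas {o h} (C : Category o h) (cp : BinCoproducts C) (M : Monad C)
                        (ord : Kleisli.OrderSaturation C cp M) where
  open Category C using (Obj; Hom)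
  open Kleisli C cp M
  open OrderSaturation ord
  open KleisliLemmas C cp M
  open Category K using (idˡ; idʳ; assoc)
  open CategoryLemmas K

  poset : Obj → Obj → Poset h h h
  poset X Y = record
    { Carrier = X ⊸ Y ; _≈_ = _≡_ ; _≤_ = _≤_ ; isPartialOrder = isPartialOrder }

  module Order {X Y : Obj} = IsPartialOrder (isPartialOrder {X} {Y})
  module Reasoning {X Y : Obj} = PosetReasoning (poset X Y)

  ·-monoʳ : ∀ {X Y Z} {f f′ : X ⊸ Y} (g : Y ⊸ Z) → f ≤ f′ → g · f ≤ g · f′
  ·-monoʳ g p = ·-mono p Order.refl

  ·-monoˡ : ∀ {X Y Z} {g g′ : Y ⊸ Z} (f : X ⊸ Y) → g ≤ g′ → g · f ≤ g′ · f
  ·-monoˡ f p = ·-mono Order.refl p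

  *-mono : ∀ {X} {α β : X ⊸ X} → α ≤ β → α * ≤ β *
  *-mono {α = α} {β} p = sat-d α (β *) (sat-a β) (Order.trans p (sat-b β)) (sat-c β)

  **≤* : ∀ {X} (α : X ⊸ X) → (α *) * ≤ α *
  **≤* α = sat-d (α *) (α *) (sat-a α) Order.refl (sat-c α)

  -- Conjugation preserves reflexivity and transitivity, so minimality of saturation applies. Axiom
  -- (e) gives nothing here, since `θ` need not be of the form `k ♯`.
  conjugate-* : ∀ {X Y} {θ : X ⊸ Y} {θ′ : Y ⊸ X} (β : X ⊸ X) →
                θ · θ′ ≡ 1K Y → θ′ · θ ≡ 1K X → (θ · (β · θ′)) * ≤ θ · (β * · θ′)
  conjugate-* {X} {Y} {θ} {θ′} β θθ′ θ′θ = sat-d _ _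
    (begin
      1K Y              ≡⟨ θθ′ ⟨
      θ · θ′            ≡⟨ cong (θ ·_) (idˡ θ′) ⟨
      θ · (1K X · θ′)   ≤⟨ ·-monoʳ θ (·-monoˡ θ′ (sat-a β)) ⟩
      θ · (β * · θ′)    ∎)
    (·-monoʳ θ (·-monoˡ θ′ (sat-b β)))
    (begin
      (θ · (β * · θ′)) · (θ · (β * · θ′))    ≡⟨ pullʳ (assoc _ _ _) ⟩
      θ · (β * · (θ′ · (θ · (β * · θ′))))    ≡⟨ cong (λ k → θ · (β * · k)) (cancelˡ θ′θ) ⟩
      θ · (β * · (β * · θ′))                 ≡⟨ cong (θ ·_) (assoc _ _ _) ⟨
      θ · ((β * · β *) · θ′)                 ≤⟨ ·-monoʳ θ (·-monoˡ θ′ (sat-c β)) ⟩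
      θ · (β * · θ′)                         ∎)
    where open Reasoning

  -- Axiom (e) extended to a morphism `k ♯` followed by a Kleisli isomorphism: conjugate `β` to the
  -- far side, apply (e) to `k`, then conjugate back.
  *-transfer-≅ : ∀ {X Y Z} {θ : Y ⊸ Z} {θ′ : Z ⊸ Y} (k : Hom X Z) (α : X ⊸ X) (β : Y ⊸ Y) →
                 θ · θ′ ≡ 1K Z → θ′ · θ ≡ 1K Y →
                 (θ′ · k ♯) · α ≤ β · (θ′ · k ♯) → (θ′ · k ♯) · α * ≤ β * · (θ′ · k ♯)
  *-transfer-≅ {θ = θ} {θ′} k α β θθ′ θ′θ p = begin
    (θ′ · k ♯) · α *                   ≡⟨ assoc _ _ _ ⟩
    θ′ · (k ♯ · α *)                   ≤⟨ ·-monoʳ θ′ (sat-e-≤ k α _ q) ⟩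
    θ′ · ((θ · (β · θ′)) * · k ♯)      ≤⟨ ·-monoʳ θ′ (·-monoˡ (k ♯) (conjugate-* β θθ′ θ′θ)) ⟩
    θ′ · ((θ · (β * · θ′)) · k ♯)      ≡⟨ cong (θ′ ·_) (pullʳ (assoc _ _ _)) ⟩
    θ′ · (θ · (β * · (θ′ · k ♯)))      ≡⟨ cancelˡ θ′θ ⟩
    β * · (θ′ · k ♯)                   ∎
    where
    open Reasoning
    q : k ♯ · α ≤ (θ · (β · θ′)) · k ♯
    q = begin
      k ♯ · α                     ≡⟨ cancelˡ θθ′ ⟨
      θ · (θ′ · (k ♯ · α))        ≡⟨ cong (θ ·_) (assoc _ _ _) ⟨
      θ · ((θ′ · k ♯) · α)        ≤⟨ ·-monoʳ θ p ⟩
      θ · (β · (θ′ · k ♯))        ≡⟨ pullʳ (assoc _ _ _) ⟨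
      (θ · (β · θ′)) · k ♯        ∎

  module MonadSaturation {S₀ : Obj → Obj} {S₁ : ∀ {X Y} → X ⊸ Y → S₀ X ⊸ S₀ Y}
                         {e : ∀ X → X ⊸ S₀ X} {m : ∀ X → S₀ (S₀ X) ⊸ S₀ X}
                         (S : IsMonad Kl S₀ S₁ e m) (compatible : SatCompatible ord S₀ S₁ e m) where
    open IsMonad S
    open IsEndofunctor isFunctor using (S-∘)

    S-mono : ∀ {X Y} {f g : X ⊸ Y} → f ≤ g → S₁ f ≤ S₁ g
    S-mono = proj₁ compatible

    step : ∀ {X} → X ⊸ S₀ X → S₀ X ⊸ S₀ X
    step {X} α = m X · S₁ α

    -- For the two monads of the setting this is definitionally `★` and `⊛`.
    sat : ∀ {X} → X ⊸ S₀ X → X ⊸ S₀ X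
    sat {X} α = step α * · e X

    step-e : ∀ {X} (α : X ⊸ S₀ X) → step α · e X ≡ α
    step-e {X} α = trans (pullʳ (sym (e-natural α))) (cancelˡ (m-e X))

    sat-extensive : ∀ {X} (α : X ⊸ S₀ X) → α ≤ sat α
    sat-extensive {X} α = begin
      α              ≡⟨ step-e α ⟨
      step α · e X   ≤⟨ ·-monoˡ (e X) (sat-b (step α)) ⟩
      sat α          ∎
      where open Reasoning

    sat-mono : ∀ {X} {α β : X ⊸ S₀ X} → α ≤ β → sat α ≤ sat β
    sat-mono {X} p = ·-monoˡ (e X) (*-mono (·-monoʳ (m X) (S-mono p)))

    -- The compatibility assumption identifies `step (sat α)` with `step α *`, which leaves
    -- idempotence of `*`.
    sat-idem : ∀ {X} (α : X ⊸ S₀ X) → sat (sat α) ≤ sat α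
    sat-idem {X} α = begin
      step (sat α) * · e X    ≡⟨ cong (λ k → k * · e X) (proj₂ compatible X α) ⟩
      (step α *) * · e X      ≤⟨ ·-monoˡ (e X) (**≤* (step α)) ⟩
      step α * · e X          ∎
      where open Reasoning

    -- A homomorphism equation extends to the `step` endomorphisms by naturality of `m`. The two
    -- halves of axiom (e), applied to `f′`, then saturate it as an equation.
    sat-hom : ∀ {X Y} {f : Hom X Y} {f′ : Hom (S₀ X) (S₀ Y)} {α : X ⊸ S₀ X} {β : Y ⊸ S₀ Y} →
              S₁ (f ♯) ≡ f′ ♯ → f′ ♯ · α ≡ β · f ♯ → f′ ♯ · sat α ≡ sat β · f ♯
    sat-hom {X} {Y} {f} {f′} {α} {β} lifts hom = begin
      f′ ♯ · (step α * · e X)       ≡⟨ extendˡ (Order.antisym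
                                         (sat-e-≤ f′ _ _ (Order.reflexive step-hom))
                                         (sat-e-≥ f′ _ _ (Order.reflexive (sym step-hom)))) ⟩
      step β * · (f′ ♯ · e X)       ≡⟨ cong (λ k → step β * · (k · e X)) lifts ⟨
      step β * · (S₁ (f ♯) · e X)   ≡⟨ cong (step β * ·_) (e-natural (f ♯)) ⟨
      step β * · (e Y · f ♯)        ≡⟨ assoc _ _ _ ⟨
      sat β · f ♯                   ∎
      where
      open ≡-Reasoning
      step-hom : f′ ♯ · step α ≡ step β · f′ ♯
      step-hom = begin
        f′ ♯ · (m X · S₁ α)               ≡⟨ cong (_· (m X · S₁ α)) lifts ⟨
        S₁ (f ♯) · (m X · S₁ α)           ≡⟨ extendˡ (sym (m-natural (f ♯))) ⟩
        m Y · (S₁ (S₁ (f ♯)) · S₁ α)      ≡⟨ cong (m Y ·_) (S-∘ _ _) ⟨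
        m Y · S₁ (S₁ (f ♯) · α)           ≡⟨ cong (λ k → m Y · S₁ (k · α)) lifts ⟩
        m Y · S₁ (f′ ♯ · α)               ≡⟨ cong (λ k → m Y · S₁ k) hom ⟩
        m Y · S₁ (β · f ♯)                ≡⟨ cong (m Y ·_) (S-∘ _ _) ⟩
        m Y · (S₁ β · S₁ (f ♯))           ≡⟨ cong (λ k → m Y · (S₁ β · k)) lifts ⟩
        m Y · (S₁ β · f′ ♯)               ≡⟨ assoc _ _ _ ⟨
        step β · f′ ♯                     ∎

-- The isomorphism between `F̄*` and the lifted free monad.

module SettingLemmas {o h} (S : Setting o h) where
  open Setting S
  open Category C using (Obj; Hom) renaming (_∘_ to _∘C_)
  open Kleisli C cp M
  open OrderSaturation ord
  open ZeroMorphisms zero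
  open Endofunctor F using (F₀; F₁)
  open Lifting F-lift renaming (lift₁ to F̄₁; isFunctor to F̄-functor; lifts to F̄-lifts)
  open Tau C cp M zero F F-lift
  open FreeAlgebras free using (F*₀; F*₁; φ; η*)
  open KleisliLemmas C cp M
  open LiftedFreeAlgebras F F-lift free using (F̄; freeK)
  open Category K using (idˡ; idʳ; assoc)
  open BinCoproducts cpK using (β₁; β₂; [_,_])
  open CategoryLemmas K
  open CoproductLemmas K cpK
  open IsEndofunctor F̄-functor using () renaming (S-∘ to F̄-∘)
  open SaturationLemmas C cp M ord
  module τ = MonadSaturation τ-isMonad τ-sat
  module ∗ = MonadSaturation *-isMonad *-sat
  module Free = FreeMonad K F̄ freeK
  open Free.Extension *-isMonad ν-natural using (alg; alg-e; extend; extend-unit; extend-morphism)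
  open IsMonad *-isMonad using (isFunctor; e-natural; m-e)
  open IsEndofunctor isFunctor using () renaming (S-∘ to F̄*-∘)

  private
    comparison = ν-universal Free.freeMonad Free.unit Free.unit-natural
    module Restrict = IsMonadMorphism (proj₁ (proj₂ comparison))

  -- Induced by universality of `ν`, in the direction opposite to `extend`, which comes from free
  -- algebras. Both have the same carrier, but the two monad structures on it may differ.
  restrict : ∀ X → F*₀ X ⊸ F*₀ X
  restrict = proj₁ comparison

  restrict-ν : ∀ X → restrict X · ν X ≡ Free.unit X
  restrict-ν = proj₁ (proj₂ (proj₂ comparison))

  -- Both sides are monad endomorphisms of `F̄*` that fix `ν`.
  extend-restrict : ∀ X → extend X · restrict X ≡ 1K (F*₀ X)
  extend-restrict X = trans
    (unique _ (composeMonadMorphism isFunctor extend-morphism (proj₁ (proj₂ comparison)))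
      (λ Y → trans (pullʳ (restrict-ν Y)) (extend-unit Y)) X)
    (sym (unique _ (idMonadMorphism isFunctor) (λ Y → idˡ (ν Y)) X))
    where
    unique = proj₂ (proj₂ (proj₂ (ν-universal (record { isMonad = *-isMonad }) ν ν-natural)))

  -- Here freeness of the algebras is used: `restrict X` is an algebra morphism from `alg X` to the
  -- free algebra, so the composite is the fold that equals the identity.
  restrict-extend : ∀ X → restrict X · extend X ≡ 1K (F*₀ X)
  restrict-extend X = begin
    restrict X · extend X                        ≡⟨ Free.fold-fusion restrict-alg ⟩
    foldK (φ X ♯) (restrict X · e X)             ≡⟨ cong (foldK _) (Restrict.pres-e X) ⟩
    foldK (φ X ♯) (η* X ♯)                       ≡⟨ Free.fold-id ⟩
    1K (F*₀ X)                                   ∎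
    where
    open ≡-Reasoning
    open FreeAlgebras freeK using () renaming (fold to foldK; F*₁ to mapK)
    restrict-alg : restrict X · alg X ≡ φ X ♯ · F̄₁ (restrict X)
    restrict-alg = begin
      restrict X · (m X · ν _)                                   ≡⟨ pullˡ (Restrict.pres-m X) ⟩
      (Free.join X · (mapK (restrict X) · restrict _)) · ν _     ≡⟨ pullʳ (pullʳ (restrict-ν _)) ⟩
      Free.join X · (mapK (restrict X) · Free.unit _)
        ≡⟨ cong (Free.join X ·_) (Free.unit-natural (restrict X)) ⟨
      Free.join X · (Free.unit _ · F̄₁ (restrict X))              ≡⟨ pullˡ (Free.join-unit X) ⟩
      φ X ♯ · F̄₁ (restrict X)                                    ∎

  -- The transformation from `F̄τ` to `F̄*` and its factorisation.

  embed : ∀ X → Fτ₀ X ⊸ F*₀ X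
  embed X = [ ν X , e X ]K

  embed-natural : IsNatural Kl Fτ₀ F̄τ₁ F*₀ F̄*₁ embed
  embed-natural {X} {Y} f = begin
    embed Y · F̄τ₁ f                     ≡⟨ [,]-∘-+ _ _ _ _ ⟩
    [ ν Y · F̄₁ f , e Y · f ]            ≡⟨ cong₂ [_,_] (ν-natural f) (e-natural f) ⟩
    [ F̄*₁ f · ν X , F̄*₁ f · e X ]       ≡⟨ ∘-[,] _ _ _ ⟨
    F̄*₁ f · embed X                     ∎
    where open ≡-Reasoning

  embedC : ∀ X → Hom (Fτ₀ X) (F*₀ X)
  embedC X = BinCoproducts.[_,_] cp (φ X ∘C F₁ (η* X)) (η* X)

  -- `extend` carries the unit and universal transformation of the lifted free monad to `e` and `ν`.
  -- As `F̄` lifts `F`, the cotuple of the former is the image of a `C`-morphism.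
  embed-factor : ∀ X → embed X ≡ extend X · embedC X ♯
  embed-factor X = begin
    [ ν X , e X ]
      ≡⟨ cong₂ [_,_] (extend-unit X) (IsMonadMorphism.pres-e extend-morphism X) ⟨
    [ extend X · Free.unit X , extend X · η* X ♯ ]       ≡⟨ ∘-[,] _ _ _ ⟨
    extend X · [ Free.unit X , η* X ♯ ]
      ≡⟨ cong (λ k → extend X · [ φ X ♯ · k , η* X ♯ ]) (F̄-lifts (η* X)) ⟩
    extend X · [ φ X ♯ · F₁ (η* X) ♯ , η* X ♯ ]
      ≡⟨ cong (λ k → extend X · [ k , η* X ♯ ]) (♯-∘ _ _) ⟨
    extend X · [ (φ X ∘C F₁ (η* X)) ♯ , η* X ♯ ]
      ≡⟨ cong (extend X ·_) (CoproductLemmas.∘-[,] C cp _ _ _) ⟨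
    extend X · embedC X ♯                                ∎
    where open ≡-Reasoning

  F̄τ-lifts : ∀ {X Y} (f : Hom X Y) → F̄τ₁ (f ♯) ≡ Fτ₁ f ♯
  F̄τ-lifts f = begin
    [ ι¹ · F̄₁ (f ♯) , ι² · f ♯ ]   ≡⟨ cong (λ k → [ ι¹ · k , ι² · f ♯ ]) (F̄-lifts f) ⟩
    [ ι¹ · F₁ f ♯ , ι² · f ♯ ]     ≡⟨ cong₂ [_,_] (♯-∘ _ _) (♯-∘ _ _) ⟨
    [ (ι₁ ∘C F₁ f) ♯ , (ι₂ ∘C f) ♯ ] ≡⟨ CoproductLemmas.∘-[,] C cp _ _ _ ⟨
    Fτ₁ f ♯                        ∎
    where
    open ≡-Reasoning
    open BinCoproducts cp using (ι₁; ι₂)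

  -- Monotonicity is assumed for `F̄τ`, of which `F̄` is a retract: `ι¹` includes it and the zero
  -- morphism yields the retraction `r`.
  F̄-mono : ∀ {X Y} {f g : X ⊸ Y} → f ≤ g → F̄₁ f ≤ F̄₁ g
  F̄-mono {X} {Y} {f} {g} p = begin
    F̄₁ f                  ≡⟨ retract f ⟨
    r · (F̄τ₁ f · ι¹)      ≤⟨ ·-monoʳ r (·-monoˡ ι¹ (τ.S-mono p)) ⟩
    r · (F̄τ₁ g · ι¹)      ≡⟨ retract g ⟩
    F̄₁ g                  ∎
    where
    open Reasoning
    r : Fτ₀ Y ⊸ F₀ Y
    r = [ 1K (F₀ Y) , 0K Y (F₀ Y) ]
    retract : ∀ k → r · (F̄τ₁ k · ι¹) ≡ F̄₁ k
    retract k = trans (cong (r ·_) (β₁ _ _)) (cancelˡ (β₁ _ _))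

  -- Comparison of the two saturations.

  module _ (cotuple-mono : CotupleMono) (zero-least : ZeroIsLeast) where

    -- Both sides are cotuples with equal second components, so only the first components need
    -- comparing.
    embed-m-lax : ∀ X → embed X · m' X ≤ m X · (F̄*₁ (embed X) · embed (Fτ₀ X))
    embed-m-lax X = begin
      embed X · ([ ι¹ , 1K _ ] · (F̄₁ [0,1] +K 1K _))   ≡⟨ cong (embed X ·_) ([,]-∘-+ _ _ _ _) ⟩
      embed X · [ ι¹ · F̄₁ [0,1] , 1K _ · 1K _ ]        ≡⟨ ∘-[,] _ _ _ ⟩
      [ embed X · (ι¹ · F̄₁ [0,1]) , embed X · (1K _ · 1K _) ]
        ≡⟨ cong₂ [_,_] (pullˡ (β₁ _ _)) (trans (cong (embed X ·_) (idˡ _)) (idʳ _)) ⟩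
      [ ν X · F̄₁ [0,1] , embed X ]                     ≤⟨ cotuple-mono left Order.refl ⟩
      [ alg X · F̄₁ (embed X) , embed X ]
        ≡⟨ cong₂ [_,_] (pullʳ (ν-natural (embed X)))
                       (trans (sym (cancelˡ (m-e X))) (cong (m X ·_) (e-natural (embed X)))) ⟩
      [ m X · (F̄*₁ (embed X) · ν _) , m X · (F̄*₁ (embed X) · e _) ]   ≡⟨ ∘-[,] _ _ _ ⟨
      m X · [ F̄*₁ (embed X) · ν _ , F̄*₁ (embed X) · e _ ]   ≡⟨ cong (m X ·_) (∘-[,] _ _ _) ⟨
      m X · (F̄*₁ (embed X) · embed (Fτ₀ X))            ∎
      where
      open Reasoning
      [0,1] : Fτ₀ X ⊸ X
      [0,1] = [ 0K (F₀ X) X , 1K X ]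
      -- Writing `ν` as `alg X` after `F̄₁ (e X)` brings `[0,1]` under `F̄₁`, where `e X · [0,1]` is
      -- the cotuple of zero and `e X`. Replacing zero by `ν X` gives the bound.
      left : ν X · F̄₁ [0,1] ≤ alg X · F̄₁ (embed X)
      left = begin
        ν X · F̄₁ [0,1]                  ≡⟨ cong (_· F̄₁ [0,1]) (alg-e X) ⟨
        (alg X · F̄₁ (e X)) · F̄₁ [0,1]   ≡⟨ pullʳ (sym (F̄-∘ _ _)) ⟩
        alg X · F̄₁ (e X · [0,1])
          ≡⟨ cong (λ k → alg X · F̄₁ k) (trans (∘-[,] _ _ _) (cong₂ [_,_] (0-left _) (idʳ _))) ⟩
        alg X · F̄₁ [ 0K _ _ , e X ]
          ≤⟨ ·-monoʳ (alg X) (F̄-mono (cotuple-mono (zero-least (ν X)) Order.refl)) ⟩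
        alg X · F̄₁ (embed X)            ∎

    embed-step : ∀ {X} (α : X ⊸ Fτ₀ X) → embed X · τ.step α ≤ ∗.step (under α) · embed X
    embed-step {X} α = begin
      embed X · (m' X · F̄τ₁ α)                                    ≡⟨ assoc _ _ _ ⟨
      (embed X · m' X) · F̄τ₁ α                          ≤⟨ ·-monoˡ (F̄τ₁ α) (embed-m-lax X) ⟩
      (m X · (F̄*₁ (embed X) · embed _)) · F̄τ₁ α         ≡⟨ pullʳ (pullʳ (embed-natural α)) ⟩
      m X · (F̄*₁ (embed X) · (F̄*₁ α · embed X))
        ≡⟨ cong (m X ·_) (pullˡ (sym (F̄*-∘ _ _))) ⟩
      m X · (F̄*₁ (under α) · embed X)                   ≡⟨ assoc _ _ _ ⟨
      ∗.step (under α) · embed X                        ∎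
      where open Reasoning

    embed-step* : ∀ {X} (α : X ⊸ Fτ₀ X) →
                  embed X · τ.step α * ≤ ∗.step (under α) * · embed X
    -- Matching on the factorisation exhibits the map as `extend X` after some `k ♯`, the shape that
    -- the transfer lemma requires.
    embed-step* {X} α with embed X | embed-factor X | embed-step α
    ... | _ | refl | p =
      *-transfer-≅ (embedC X) _ _ (restrict-extend X) (extend-restrict X) p

    -- The saturated inequality is precomposed with the unit `ι²`, which `embed X` sends to `e X`.
    under-★≤ : ∀ {X} (α : X ⊸ Fτ₀ X) → under (α ★) ≤ under α ⊛
    under-★≤ {X} α = begin
      embed X · (τ.step α * · ι²)                ≡⟨ assoc _ _ _ ⟨
      (embed X · τ.step α *) · ι²                ≤⟨ ·-monoˡ ι² (embed-step* α) ⟩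
      (∗.step (under α) * · embed X) · ι²        ≡⟨ pullʳ (β₂ _ _) ⟩
      ∗.step (under α) * · e X                   ∎
      where open Reasoning

    -- One inequality follows from `α ≤ α ★`; the other from the preceding bound and idempotence of
    -- `⊛`.
    under-⊛-★ : ∀ {X} (α : X ⊸ Fτ₀ X) → under α ⊛ ≡ under (α ★) ⊛
    under-⊛-★ {X} α = Order.antisym
      (∗.sat-mono (·-monoʳ (embed X) (τ.sat-extensive α)))
      (Order.trans (∗.sat-mono (under-★≤ α)) (∗.sat-idem (under α)))

    -- The hypothesis concerns `α ★` and an arbitrary `γ`, so `under α` is first replaced by
    -- `under (α ★)` inside `⊛`. Naturality of `embed` then moves the homomorphism to `F̄*`, and
    -- saturation preserves it.
    ⊛-hom : ∀ {X Z} {f : Hom X Z} (α : X ⊸ Fτ₀ X) (γ : Z ⊸ Fτ₀ Z) →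
            TFτ₁ f ∘C α ★ ≡ γ ∘C f → TF*₁ f ∘C under α ⊛ ≡ under γ ⊛ ∘C f
    ⊛-hom {X} {Z} {f} α γ hom = begin
      TF*₁ f ∘C under α ⊛           ≡⟨ ♯-· _ _ ⟨
      F*₁ f ♯ · under α ⊛           ≡⟨ cong (F*₁ f ♯ ·_) (under-⊛-★ α) ⟩
      F*₁ f ♯ · under (α ★) ⊛       ≡⟨ ∗.sat-hom (F̄*-lifts f) under-hom ⟩
      under γ ⊛ · f ♯               ≡⟨ ·-♯ _ _ ⟩
      under γ ⊛ ∘C f                ∎
      where
      open ≡-Reasoning
      under-hom : F*₁ f ♯ · under (α ★) ≡ under γ · f ♯
      under-hom = begin
        F*₁ f ♯ · (embed X · α ★)         ≡⟨ cong (_· under (α ★)) (F̄*-lifts f) ⟨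
        F̄*₁ (f ♯) · (embed X · α ★)       ≡⟨ extendˡ (sym (embed-natural (f ♯))) ⟩
        embed Z · (F̄τ₁ (f ♯) · α ★)       ≡⟨ cong (λ k → embed Z · (k · α ★)) (F̄τ-lifts f) ⟩
        embed Z · (Fτ₁ f ♯ · α ★)         ≡⟨ cong (embed Z ·_) (♯-· _ _) ⟩
        embed Z · (TFτ₁ f ∘C α ★)         ≡⟨ cong (embed Z ·_) hom ⟩
        embed Z · (γ ∘C f)                ≡⟨ cong (embed Z ·_) (·-♯ _ _) ⟨
        embed Z · (γ · f ♯)               ≡⟨ assoc _ _ _ ⟨
        under γ · f ♯                     ∎

theorem8 : ∀ {o h} (S : Setting o h) →
             let open Setting S
                 open Category C
                 open Tau C cp M zero F F-lift
             in CotupleMono → ZeroIsLeast →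
                ∀ {X : Obj} (α : Hom X (TFτ₀ X)) {R : Obj} (π₁ : Hom R X) (π₂ : Hom R X) →
                IsBisimulation C TFτ₀ TFτ₁ (α ★) (α ★) π₁ π₂ →
                IsBisimulation C TF*₀ TF*₁ ((under α) ⊛) ((under α) ⊛) π₁ π₂
theorem8 S cotuple-mono zero-least α π₁ π₂ bisim = record
  { jointlyMonic = jointlyMonic
  ; Z        = Z
  -- Only the coalgebra on `Z` changes. The cospan stays the same, so the pullback and joint
  -- monicity carry over.
  ; γ        = under γ ⊛
  ; f        = f
  ; g        = g
  ; f-hom    = ⊛-hom cotuple-mono zero-least α γ f-hom
  ; g-hom    = ⊛-hom cotuple-mono zero-least α γ g-hom
  ; pullback = pullback
  }
  where
  open Setting S
  open SettingLemmas S
  open IsBisimulation bisim
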